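{- If $D$ is a sourceless digraph with $n$ vertices and maximum out-degree $\Delta^+(D)\le 3$, then $D$ contains a quasi-kernel of order at most $\frac{4n}{7}$.
   Context: Digraphs are finite, without loops and without repeated edges $(u,v)$; both $(u,v)$ and $(v,u)$ may be present. A source is a vertex with in-degree zero; a digraph is sourceless if it has no source. $\dist(v,u)$ is the length of a shortest directed path from $v$ to $u$ ($\infty$ if none exists). A quasi-kernel of $D$ is an independent set $Q$ (no edges in either direction between vertices of $Q$) such that for every vertex $u$ of $D$ there is $v\in Q$ with $\dist(v,u)\le 2$. -}

module Defs where

open import Data.Nat using (ℕ; zero; suc; _≤_)
open import Data.Fin using (Fin)
open import Data.Fin.Subset using (Subset; _∈_; _∉_; ∣_∣)
open import Data.List using (List; []; _∷_; tabulate)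
open import Data.List.Extrema.Nat using (max)
open import Data.List.Relation.Unary.Unique.Propositional using (Unique)
open import Data.Product using (Σ; ∃; _×_)
import Data.Vec as Vec
open import Relation.Nullary using (¬_)
open import Relation.Binary.PropositionalEquality using (_≡_)

-- The vertex set is Fin n.  Since out-neighbourhoods are sets, there are no
-- repeated edges, while opposite edges (u , v) and (v , u) may coexist.
record Digraph (n : ℕ) : Set where
  field
    outNbhd : Fin n → Subset n
    noLoop  : ∀ v → v ∉ outNbhd v

  Edge : Fin n → Fin n → Set
  Edge u v = v ∈ outNbhd u

  inNbhd : Fin n → Subset n
  inNbhd v = Vec.tabulate λ u → Vec.lookup (outNbhd u) v

  outDegree : Fin n → ℕ
  outDegree v = ∣ outNbhd v ∣

  inDegree : Fin n → ℕ
  inDegree v = ∣ inNbhd v ∣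

  -- Equal to 0 for the digraph without vertices.
  maxOutDegree : ℕ
  maxOutDegree = max 0 (tabulate outDegree)

  Source : Fin n → Set
  Source v = inDegree v ≡ 0

  Sourceless : Set
  Sourceless = ¬ ∃ Source

  data Walk : Fin n → Fin n → ℕ → Set where
    []  : ∀ {v} → Walk v v zero
    _∷_ : ∀ {v w u k} → Edge v w → Walk w u k → Walk v u (suc k)

  vertices : ∀ {v u k} → Walk v u k → List (Fin n)
  vertices {v} []      = v ∷ []
  vertices {v} (_ ∷ p) = v ∷ vertices p

  Path : Fin n → Fin n → ℕ → Set
  Path v u k = Σ (Walk v u k) λ p → Unique (vertices p)

  -- dist(v,u) = d for a natural number d; dist(v,u) = ∞ means that there is
  -- no such d.
  IsDist : Fin n → Fin n → ℕ → Set
  IsDist v u d = Path v u d × (∀ {k} → Path v u k → d ≤ k)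

  DistAtMost : ℕ → Fin n → Fin n → Set
  DistAtMost m v u = ∃ λ d → IsDist v u d × d ≤ m

  Independent : Subset n → Set
  Independent Q = ∀ {u v} → u ∈ Q → v ∈ Q → ¬ Edge u v

  record QuasiKernel (Q : Subset n) : Set where
    field
      independent : Independent Q
      reaches     : ∀ u → ∃ λ v → v ∈ Q × DistAtMost 2 v u

{-# OPTIONS --safe #-}
module Submission where

-- Let Q be a quasi-kernel and W its complement.  If 3 |Q| ≤ 4 |W| then Q is
-- small enough.  Otherwise one uses a set P ⊆ W, all of whose subsets have
-- kernels, that dominates W \ P: if R is the set of vertices of Q not dominated
-- by P, and K a kernel of the part of P not dominated by R, then R ∪ K is a
-- quasi-kernel, because every vertex has an in-neighbour in P or lies in P ∪ R,
-- and P ∪ R is dominated by R ∪ K.  Every vertex of R has its in-neighbours in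
-- W \ P, so it suffices that |P| plus the number of vertices of Q dominated by
-- W \ P is at most 4|W|/3.  Such a P is built inductively over S ⊆ W.  A vertex
-- with at most one out-neighbour in Q costs at most 1 either way, so it is put into
-- P exactly when P does not dominate it; a sink of S can always be put into P.  If
-- neither exists, each vertex of S has exactly one out-neighbour in W, so there are
-- edges s → t → v in S.  If v = s, this is a 2-cycle without further out-edges and
-- is added to P.  Otherwise leaving out v, at cost 2, allows adding s and then t
-- as sinks: cost 4 for three vertices.

open import Defs
open import Data.Empty using (⊥-elim)
open import Data.Fin using (Fin; _≟_)
open import Data.Fin.Properties using (any?)
open import Data.Fin.Subset
  using (Subset; ∣_∣; _∈_; _∉_; _⊆_; _∪_; _∩_; _─_; _-_; ⁅_⁆; ∁; ⊤; ⊥; inside; outside)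
open import Data.Fin.Subset.Properties
open import Data.List.Extrema.Nat using (xs≤max)
open import Data.List.Relation.Unary.All using ([]; _∷_)
open import Data.List.Relation.Unary.All.Properties using (tabulate⁻)
open import Data.List.Relation.Unary.AllPairs using ([]; _∷_)
open import Data.Nat using (ℕ; suc; _+_; _*_; _≤_; _<_; z≤n; s≤s; _≤?_)
open import Data.Nat.Induction using (<-wellFounded)
open import Data.Nat.Properties hiding (_≟_)
open import Data.Nat.Solver using (module +-*-Solver)
open import Data.Product using (∃; _×_; _,_; proj₁; proj₂)
open import Data.Sum using (_⊎_; inj₁; inj₂)
open import Data.Vec using (tabulate; []; _∷_; here; there)
open import Data.Vec.Properties using (lookup∘tabulate; lookup⇒[]=; []=⇒lookup)
open import Function using (_∘_; id)
open import Induction.WellFounded using (Acc; acc)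
open import Relation.Binary.PropositionalEquality
  using (_≡_; _≢_; refl; sym; trans; cong; subst)
open import Relation.Nullary using (¬_; Dec; yes; no; does)
open import Relation.Nullary.Decidable using (_×-dec_; ¬?; dec-true)
open import Relation.Unary using (Decidable)

-- Finite subsets and their cardinalities.

private
  variable
    n : ℕ

⟦_⟧ : {P : Fin n → Set} → Decidable P → Subset n
⟦ P? ⟧ = tabulate (does ∘ P?)

∈⟦⟧⁺ : {P : Fin n → Set} (P? : Decidable P) {x : Fin n} → P x → x ∈ ⟦ P? ⟧
∈⟦⟧⁺ P? {x} px = lookup⇒[]= x _ (trans (lookup∘tabulate _ x) (dec-true (P? x) px))

∈⟦⟧⁻ : {P : Fin n → Set} (P? : Decidable P) {x : Fin n} → x ∈ ⟦ P? ⟧ → P x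
∈⟦⟧⁻ P? {x} x∈ with P? x | trans (sym (lookup∘tabulate (does ∘ P?) x)) ([]=⇒lookup x∈)
... | yes px | _  = px
... | no _   | ()

x∈p─q⇒x∉q : ∀ (p q : Subset n) {x} → x ∈ p ─ q → x ∉ q
x∈p─q⇒x∉q (_ ∷ p) (_ ∷ q) (there x∈) (there x∈q) = x∈p─q⇒x∉q p q x∈ x∈q
x∈p─q⇒x∉q (_ ∷ p) (inside ∷ q) () here

x∈p-y⇒x≢y : ∀ (p : Subset n) y {x} → x ∈ p - y → x ≢ y
x∈p-y⇒x≢y p y x∈ refl = x∈p─q⇒x∉q p ⁅ y ⁆ x∈ (x∈⁅x⁆ y)

x∈p-y⇒x∈p : ∀ (p : Subset n) y {x} → x ∈ p - y → x ∈ p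
x∈p-y⇒x∈p p y = p─q⊆p p ⁅ y ⁆

∣p∪q∣≤∣p∣+∣q∣ : ∀ (p q : Subset n) → ∣ p ∪ q ∣ ≤ ∣ p ∣ + ∣ q ∣
∣p∪q∣≤∣p∣+∣q∣ []            []            = z≤n
∣p∪q∣≤∣p∣+∣q∣ (outside ∷ p) (outside ∷ q) = ∣p∪q∣≤∣p∣+∣q∣ p q
∣p∪q∣≤∣p∣+∣q∣ (outside ∷ p) (inside ∷ q)  =
  ≤-trans (s≤s (∣p∪q∣≤∣p∣+∣q∣ p q)) (≤-reflexive (sym (+-suc ∣ p ∣ ∣ q ∣)))
∣p∪q∣≤∣p∣+∣q∣ (inside ∷ p)  (outside ∷ q) = s≤s (∣p∪q∣≤∣p∣+∣q∣ p q)
∣p∪q∣≤∣p∣+∣q∣ (inside ∷ p)  (inside ∷ q)  =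
  s≤s (≤-trans (∣p∪q∣≤∣p∣+∣q∣ p q) (+-monoʳ-≤ ∣ p ∣ (n≤1+n ∣ q ∣)))

infixl 6 _▸_

_▸_ : Subset n → Fin n → Subset n
p ▸ x = p ∪ ⁅ x ⁆

x∈p▸x : ∀ (p : Subset n) x → x ∈ p ▸ x
x∈p▸x p x = q⊆p∪q p ⁅ x ⁆ (x∈⁅x⁆ x)

p⊆p▸x : ∀ (p : Subset n) x → p ⊆ p ▸ x
p⊆p▸x p x = p⊆p∪q ⁅ x ⁆

y∈p▸x⁻ : ∀ (p : Subset n) x {y} → y ∈ p ▸ x → y ∈ p ⊎ y ≡ x
y∈p▸x⁻ p x y∈ with x∈p∪q⁻ p ⁅ x ⁆ y∈
... | inj₁ y∈p = inj₁ y∈p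
... | inj₂ y∈x = inj₂ (x∈⁅y⁆⇒x≡y x y∈x)

▸⊆ : ∀ {p q : Subset n} {x} → p ⊆ q → x ∈ q → p ▸ x ⊆ q
▸⊆ {p = p} {x = x} p⊆q x∈q y∈ with y∈p▸x⁻ p x y∈
... | inj₁ y∈p = p⊆q y∈p
... | inj₂ refl = x∈q

∣p▸x∣≤ : ∀ (p : Subset n) x → ∣ p ▸ x ∣ ≤ ∣ p ∣ + 1
∣p▸x∣≤ p x = ≤-trans (∣p∪q∣≤∣p∣+∣q∣ p ⁅ x ⁆) (+-monoʳ-≤ ∣ p ∣ (≤-reflexive (∣⁅x⁆∣≡1 x)))

⊆▸∧∉⇒⊆ : ∀ {p q : Subset n} {x} → p ⊆ q ▸ x → x ∉ p → p ⊆ q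
⊆▸∧∉⇒⊆ {q = q} {x} p⊆ x∉p y∈p with y∈p▸x⁻ q x (p⊆ y∈p)
... | inj₁ y∈q  = y∈q
... | inj₂ refl = ⊥-elim (x∉p y∈p)

p⊆q▸x⇒p-x⊆q : ∀ (p q : Subset n) x → p ⊆ q ▸ x → p - x ⊆ q
p⊆q▸x⇒p-x⊆q p q x p⊆ = ⊆▸∧∉⇒⊆ (p⊆ ∘ x∈p-y⇒x∈p p x) (λ x∈ → x∈p-y⇒x≢y p x x∈ refl)

∣p∣≢0⇒nonempty : ∀ (p : Subset n) → ¬ (∣ p ∣ ≡ 0) → ∃ (_∈ p)
∣p∣≢0⇒nonempty {n} p ∣p∣≢0 with nonempty? p
... | yes ne = ne
... | no ¬ne = ⊥-elim (∣p∣≢0 (trans (cong ∣_∣ (Empty-unique ¬ne)) (∣⊥∣≡0 n)))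

∣p∣+∣∁p∣≡n : ∀ (p : Subset n) → ∣ p ∣ + ∣ ∁ p ∣ ≡ n
∣p∣+∣∁p∣≡n p = trans (cong (∣ p ∣ +_) (∣∁p∣≡n∸∣p∣ p)) (m+[n∸m]≡n (∣p∣≤n p))

-- Edges, distances and domination.

module _ (D : Digraph n) where
  open Digraph D

  edge? : ∀ u v → Dec (Edge u v)
  edge? u v = v ∈? outNbhd u

  outDegree≤max : ∀ v → outDegree v ≤ maxOutDegree
  outDegree≤max = tabulate⁻ (xs≤max 0 _)

  edge⇒≢ : ∀ {u v} → Edge u v → u ≢ v
  edge⇒≢ e refl = noLoop _ e

  sourceless⇒inNeighbour : Sourceless → ∀ v → ∃ λ u → Edge u v
  sourceless⇒inNeighbour sl v with ∣p∣≢0⇒nonempty (inNbhd v) (λ eq → sl (v , eq))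
  ... | u , u∈ = u , lookup⇒[]= v _ (trans (sym (lookup∘tabulate _ u)) ([]=⇒lookup u∈))

  -- The walk need not be shortest, and in the last case `u` may even equal `v`. This makes
  -- witnesses easy to build; `near⇒dist` recovers the distance.
  Near : Fin n → Fin n → Set
  Near v u = v ≡ u ⊎ Edge v u ⊎ ∃ λ w → Edge v w × Edge w u

  -- The lengths 0, 1, 2 are tried in this order. A walk of length 2 is used only when `v ≢ u` and
  -- there is no edge from `v` to `u`; it is then shortest, and a path since there are no loops.
  near⇒dist : ∀ {v u} → Near v u → DistAtMost 2 v u
  near⇒dist {v} {u} near with v ≟ u
  near⇒dist near | yes refl = 0 , (([] , [] ∷ []) , λ _ → z≤n) , z≤n
  near⇒dist {v} {u} near | no v≢u with edge? v u
  near⇒dist {v} {u} near | no v≢u | yes e =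
    1 , (((e ∷ []) , (v≢u ∷ []) ∷ [] ∷ []) , λ { ([] , _) → ⊥-elim (v≢u refl)
                                                ; (_ ∷ _ , _) → s≤s z≤n })
      , s≤s z≤n
  near⇒dist (inj₁ eq)        | no v≢u | no ¬e = ⊥-elim (v≢u eq)
  near⇒dist (inj₂ (inj₁ e))  | no v≢u | no ¬e = ⊥-elim (¬e e)
  near⇒dist (inj₂ (inj₂ (w , e , e′))) | no v≢u | no ¬e =
    2 , ( ((e ∷ e′ ∷ []) , (edge⇒≢ e ∷ v≢u ∷ []) ∷ (edge⇒≢ e′ ∷ []) ∷ [] ∷ [])
        , λ { ([] , _) → ⊥-elim (v≢u refl)
            ; (f ∷ [] , _) → ⊥-elim (¬e f)
            ; (_ ∷ _ ∷ _ , _) → s≤s (s≤s z≤n) })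
      , s≤s (s≤s z≤n)

  Dominated : Subset n → Fin n → Set
  Dominated P v = ∃ λ u → u ∈ P × Edge u v

  dominated? : ∀ P v → Dec (Dominated P v)
  dominated? P v = any? λ u → (u ∈? P) ×-dec edge? u v

  dominated-mono : ∀ {P P′ v} → P ⊆ P′ → Dominated P v → Dominated P′ v
  dominated-mono P⊆P′ (u , u∈P , e) = u , P⊆P′ u∈P , e

  -- Edges lead from `P` to what it absorbs, as for quasi-kernels; kernels are often defined with
  -- the edges reversed.
  Absorbed : Subset n → Fin n → Set
  Absorbed P v = v ∈ P ⊎ Dominated P v

  absorbed-mono : ∀ {P P′ v} → P ⊆ P′ → Absorbed P v → Absorbed P′ v
  absorbed-mono P⊆P′ (inj₁ v∈P) = inj₁ (P⊆P′ v∈P)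
  absorbed-mono P⊆P′ (inj₂ d)   = inj₂ (dominated-mono P⊆P′ d)

  independent-▸ : ∀ {K x} → Independent K → ¬ Dominated K x →
                  (∀ {y} → y ∈ K → ¬ Edge x y) → Independent (K ▸ x)
  independent-▸ {K} {x} ind ¬in ¬out u∈ v∈ e with y∈p▸x⁻ K x u∈ | y∈p▸x⁻ K x v∈
  ... | inj₁ u∈K  | inj₁ v∈K  = ind u∈K v∈K e
  ... | inj₁ u∈K  | inj₂ refl = ¬in (_ , u∈K , e)
  ... | inj₂ refl | inj₁ v∈K  = ¬out v∈K e
  ... | inj₂ refl | inj₂ refl = noLoop _ e

  -- Existence of quasi-kernels.

  beyond? : ∀ H x → Decidable (λ h → h ∈ H × h ≢ x × ¬ Edge x h)
  beyond? H x h = (h ∈? H) ×-dec ¬? (h ≟ x) ×-dec ¬? (edge? x h)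

  -- The part of `H` still to be handled once `x` is chosen; it serves for quasi-kernels and for
  -- kernels.
  beyond : Subset n → Fin n → Subset n
  beyond H x = ⟦ beyond? H x ⟧

  beyond-elim : ∀ H x {h} → h ∈ H → h ≡ x ⊎ Edge x h ⊎ h ∈ beyond H x
  beyond-elim H x {h} h∈H with h ≟ x | edge? x h
  ... | yes eq | _     = inj₁ eq
  ... | no _   | yes e = inj₂ (inj₁ e)
  ... | no h≢x | no ¬e = inj₂ (inj₂ (∈⟦⟧⁺ (beyond? H x) (h∈H , h≢x , ¬e)))

  -- The Chvátal–Lovász argument.
  quasiKernelOn : ∀ S → Acc _<_ ∣ S ∣ →
    ∃ λ Q → Q ⊆ S × Independent Q × (∀ {u} → u ∈ S → ∃ λ v → v ∈ Q × Near v u)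
  quasiKernelOn S (acc rs) with nonempty? S
  ... | no ¬ne = S , id , (λ u∈S → ⊥-elim (¬ne (_ , u∈S))) , λ u∈S → _ , u∈S , inj₁ refl
  ... | yes (x , x∈S)
    with quasiKernelOn (beyond S x)
           (rs (p⊂q⇒∣p∣<∣q∣
             ( (λ h∈ → proj₁ (∈⟦⟧⁻ (beyond? S x) h∈))
             , x , x∈S , λ x∈ → proj₁ (proj₂ (∈⟦⟧⁻ (beyond? S x) x∈)) refl)))
  ... | Q , Q⊆ , ind , reach with dominated? Q x
  -- An in-neighbour `q` of `x` reaches the out-neighbours of `x` in two steps, so `x` can stay out.
  -- Without one, `x` joins and covers them itself.
  ...   | yes (q , q∈Q , e) = Q , (λ h∈ → proj₁ (∈⟦⟧⁻ (beyond? S x) (Q⊆ h∈))) , ind , reach′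
    where
    reach′ : ∀ {u} → u ∈ S → ∃ λ v → v ∈ Q × Near v u
    reach′ u∈S with beyond-elim S x u∈S
    ... | inj₁ refl       = q , q∈Q , inj₂ (inj₁ e)
    ... | inj₂ (inj₁ e′)  = q , q∈Q , inj₂ (inj₂ (x , e , e′))
    ... | inj₂ (inj₂ u∈)  = reach u∈
  ...   | no ¬dom =
    Q ▸ x , ▸⊆ (λ h∈ → proj₁ (∈⟦⟧⁻ (beyond? S x) (Q⊆ h∈))) x∈S
    , independent-▸ ind ¬dom (λ y∈Q → proj₂ (proj₂ (∈⟦⟧⁻ (beyond? S x) (Q⊆ y∈Q))))
    , reach′
    where
    reach′ : ∀ {u} → u ∈ S → ∃ λ v → v ∈ Q ▸ x × Near v u
    reach′ u∈S with beyond-elim S x u∈S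
    ... | inj₁ refl      = x , x∈p▸x Q x , inj₁ refl
    ... | inj₂ (inj₁ e)  = x , x∈p▸x Q x , inj₂ (inj₁ e)
    ... | inj₂ (inj₂ u∈) with reach u∈
    ...   | v , v∈Q , near = v , p⊆p▸x Q x v∈Q , near

  -- Kernels and kernel-perfect sets.

  record Kernel (H : Subset n) : Set where
    constructor kernel
    field
      K           : Subset n
      K⊆H         : K ⊆ H
      independent : Independent K
      absorbs     : ∀ {h} → h ∈ H → Absorbed K h

  -- All subsets are required because the one needed in the end, the part of `P` not dominated by
  -- `R`, itself depends on `P`.
  KernelPerfect : Subset n → Set
  KernelPerfect P = ∀ {H} → H ⊆ P → Kernel H

  kernelPerfect-⊥ : KernelPerfect ⊥
  kernelPerfect-⊥ {H} H⊆⊥ =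
    kernel H id (λ u∈H _ → ⊥-elim (∉⊥ (H⊆⊥ u∈H))) inj₁

  -- Nothing in `P` dominates `x`, so a kernel of `H` must contain `x` and hence avoid its
  -- out-neighbours. The rest of `H` lies in `P` and supplies the other members.
  kernelPerfect-source : ∀ {P x} → KernelPerfect P → ¬ Dominated P x → KernelPerfect (P ▸ x)
  kernelPerfect-source {P} {x} kp ¬dom {H} H⊆ with x ∈? H
  ... | no x∉H = kp (⊆▸∧∉⇒⊆ H⊆ x∉H)
  ... | yes x∈H = kernel (K ▸ x) (▸⊆ K⊆H′ x∈H)
      (independent-▸ ind (λ d → ¬dom (dominated-mono (B⊆P ∘ K⊆B) d))
        (λ y∈K → proj₂ (proj₂ (∈⟦⟧⁻ (beyond? H x) (K⊆B y∈K)))))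
      absorbs′
    where
    B⊆P : beyond H x ⊆ P
    B⊆P h∈ with ∈⟦⟧⁻ (beyond? H x) h∈
    ... | h∈H , h≢x , _ with y∈p▸x⁻ P x (H⊆ h∈H)
    ...   | inj₁ h∈P = h∈P
    ...   | inj₂ eq  = ⊥-elim (h≢x eq)
    open Kernel (kp B⊆P) renaming (K⊆H to K⊆B; independent to ind)
    K⊆H′ : K ⊆ H
    K⊆H′ k∈ = proj₁ (∈⟦⟧⁻ (beyond? H x) (K⊆B k∈))
    absorbs′ : ∀ {h} → h ∈ H → Absorbed (K ▸ x) h
    absorbs′ h∈H with beyond-elim H x h∈H
    ... | inj₁ refl      = inj₁ (x∈p▸x K x)
    ... | inj₂ (inj₁ e)  = inj₂ (x , x∈p▸x K x , e)
    ... | inj₂ (inj₂ h∈) = absorbed-mono (p⊆p▸x K x) (absorbs h∈)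

  -- A kernel of `H - x` receives no edge from `x`, so `x` can be added to it unless it already
  -- dominates `x`.
  kernelPerfect-sink : ∀ {P x} → KernelPerfect P → (∀ {y} → y ∈ P → ¬ Edge x y) →
                       KernelPerfect (P ▸ x)
  kernelPerfect-sink {P} {x} kp ¬out {H} H⊆ with x ∈? H
  ... | no x∉H = kp (⊆▸∧∉⇒⊆ H⊆ x∉H)
  ... | yes x∈H = go (dominated? K x)
    where
    H-x⊆P : H - x ⊆ P
    H-x⊆P = p⊆q▸x⇒p-x⊆q H P x H⊆
    open Kernel (kp {H - x} H-x⊆P) renaming (K⊆H to K⊆H-x; independent to ind)
    K⊆H : K ⊆ H
    K⊆H = x∈p-y⇒x∈p H x ∘ K⊆H-x
    extend : ∀ {K′} → K ⊆ K′ → Absorbed K′ x → ∀ {h} → h ∈ H → Absorbed K′ h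
    extend K⊆K′ abs-x {h} h∈H with h ≟ x
    ... | yes refl = abs-x
    ... | no h≢x   = absorbed-mono K⊆K′ (absorbs (x∈p∧x≢y⇒x∈p-y h∈H h≢x))
    go : Dec (Dominated K x) → Kernel H
    go (yes dom) = kernel K K⊆H ind (extend id (inj₂ dom))
    go (no ¬dom) = kernel (K ▸ x) (▸⊆ K⊆H x∈H) (independent-▸ ind ¬dom (¬out ∘ H-x⊆P ∘ K⊆H-x))
      (extend (p⊆p▸x K x) (inj₁ (x∈p▸x K x)))

  -- Take a kernel of `H` without `s` and `t`. If it misses one of the two, add that one: it
  -- dominates the other along the 2-cycle. If only one of them lies in `H`, it acts as a sink.
  kernelPerfect-2cycle : ∀ {P s t} → KernelPerfect P →
    (∀ {y} → y ∈ P → ¬ Edge s y) → (∀ {y} → y ∈ P → ¬ Edge t y) →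
    Edge s t → Edge t s → KernelPerfect (P ▸ s ▸ t)
  kernelPerfect-2cycle {P} {s} {t} kp ¬out-s ¬out-t st ts {H} H⊆ with t ∈? H
  ... | no t∉H = kernelPerfect-sink kp ¬out-s (⊆▸∧∉⇒⊆ H⊆ t∉H)
  ... | yes t∈H with s ∈? H
  ...   | no s∉H = kernelPerfect-sink kp ¬out-t H⊆P▸t
    where
    H⊆P▸t : H ⊆ P ▸ t
    H⊆P▸t h∈H with y∈p▸x⁻ (P ▸ s) t (H⊆ h∈H)
    ... | inj₂ refl = x∈p▸x P t
    ... | inj₁ h∈ with y∈p▸x⁻ P s h∈
    ...   | inj₁ h∈P = p⊆p▸x P t h∈P
    ...   | inj₂ refl = ⊥-elim (s∉H h∈H)
  ...   | yes s∈H = go (dominated? K s) (dominated? K t)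
    where
    H-t-s⊆P : H - t - s ⊆ P
    H-t-s⊆P = p⊆q▸x⇒p-x⊆q (H - t) P s (p⊆q▸x⇒p-x⊆q H (P ▸ s) t H⊆)
    open Kernel (kp {H - t - s} H-t-s⊆P) renaming (K⊆H to K⊆H-t-s; independent to ind)
    K⊆P : K ⊆ P
    K⊆P = H-t-s⊆P ∘ K⊆H-t-s
    K⊆H : K ⊆ H
    K⊆H = x∈p-y⇒x∈p H t ∘ x∈p-y⇒x∈p (H - t) s ∘ K⊆H-t-s
    extend : ∀ {K′} → K ⊆ K′ → Absorbed K′ s → Absorbed K′ t → ∀ {h} → h ∈ H → Absorbed K′ h
    extend K⊆K′ abs-s abs-t {h} h∈H with h ≟ s | h ≟ t
    ... | yes refl | _        = abs-s
    ... | no _     | yes refl = abs-t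
    ... | no h≢s   | no h≢t   =
      absorbed-mono K⊆K′ (absorbs (x∈p∧x≢y⇒x∈p-y (x∈p∧x≢y⇒x∈p-y h∈H h≢t) h≢s))
    go : Dec (Dominated K s) → Dec (Dominated K t) → Kernel H
    go (yes dom-s) (yes dom-t) = kernel K K⊆H ind (extend id (inj₂ dom-s) (inj₂ dom-t))
    go (no ¬dom-s) _ = kernel (K ▸ s) (▸⊆ K⊆H s∈H) (independent-▸ ind ¬dom-s (¬out-s ∘ K⊆P))
      (extend (p⊆p▸x K s) (inj₁ (x∈p▸x K s)) (inj₂ (s , x∈p▸x K s , st)))
    go _ (no ¬dom-t) = kernel (K ▸ t) (▸⊆ K⊆H t∈H) (independent-▸ ind ¬dom-t (¬out-t ∘ K⊆P))
      (extend (p⊆p▸x K t) (inj₂ (t , x∈p▸x K t , ts)) (inj₁ (x∈p▸x K t)))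

  -- Selections and their cost.

  module _ (Δ≤3 : maxOutDegree ≤ 3) (Q : Subset n) where

    outDegree≤3 : ∀ v → outDegree v ≤ 3
    outDegree≤3 v = ≤-trans (outDegree≤max v) Δ≤3

    toQ : Fin n → Subset n
    toQ v = Q ∩ outNbhd v

    ∣toQ∣≤2 : ∀ {v y} → y ∉ Q → Edge v y → ∣ toQ v ∣ ≤ 2
    ∣toQ∣≤2 {v} {y} y∉Q e = ≤-pred (begin
      suc ∣ toQ v ∣         ≤⟨ s≤s (p⊆q⇒∣p∣≤∣q∣ toQ⊆) ⟩
      suc ∣ outNbhd v - y ∣ ≤⟨ x∈p⇒∣p-x∣<∣p∣ e ⟩
      outDegree v           ≤⟨ outDegree≤3 v ⟩
      3                     ∎)
      where
      open ≤-Reasoning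
      toQ⊆ : toQ v ⊆ outNbhd v - y
      toQ⊆ z∈ with x∈p∩q⁻ Q (outNbhd v) z∈
      ... | z∈Q , z∈N = x∈p∧x≢y⇒x∈p-y z∈N λ { refl → y∉Q z∈Q }

    -- Two of the at most three out-edges are spent outside `Q`. Read contrapositively, a vertex
    -- with two out-neighbours in `Q` has at most one outside.
    ∣toQ∣≤1 : ∀ {v y z} → y ∉ Q → z ∉ Q → Edge v y → Edge v z → y ≢ z → ∣ toQ v ∣ ≤ 1
    ∣toQ∣≤1 {v} {y} {z} y∉Q z∉Q vy vz y≢z = ≤-pred (≤-pred (begin
      2 + ∣ toQ v ∣             ≤⟨ s≤s (s≤s (p⊆q⇒∣p∣≤∣q∣ toQ⊆)) ⟩
      2 + ∣ outNbhd v - z - y ∣ ≤⟨ s≤s (x∈p⇒∣p-x∣<∣p∣ (x∈p∧x≢y⇒x∈p-y vy y≢z)) ⟩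
      1 + ∣ outNbhd v - z ∣     ≤⟨ x∈p⇒∣p-x∣<∣p∣ vz ⟩
      outDegree v               ≤⟨ outDegree≤3 v ⟩
      3                         ∎))
      where
      open ≤-Reasoning
      toQ⊆ : toQ v ⊆ outNbhd v - z - y
      toQ⊆ w∈ with x∈p∩q⁻ Q (outNbhd v) w∈
      ... | w∈Q , w∈N = x∈p∧x≢y⇒x∈p-y (x∈p∧x≢y⇒x∈p-y w∈N λ { refl → z∉Q w∈Q })
                                       λ { refl → y∉Q w∈Q }

    -- B collects the vertices of Q dominated by S \ P.
    record Selection (S : Subset n) : Set where
      constructor selection
      field
        P B    : Subset n
        P⊆S    : P ⊆ S
        perfect : KernelPerfect P
        split  : ∀ {v} → v ∈ S → v ∈ P ⊎ (Dominated P v × toQ v ⊆ B)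
        cost   : 3 * (∣ P ∣ + ∣ B ∣) ≤ 4 * ∣ S ∣

    -- Enlarging `S` by `b` vertices at extra cost `a` preserves the ratio 4/3 if `a / b` does not
    -- exceed it. The pairs used are 1/1, 2/2 and 4/3.
    cost-step : ∀ {c s c′ s′} a b → 3 * c ≤ 4 * s → c′ ≤ c + a → b + s ≤ s′ →
                3 * a ≤ 4 * b → 3 * c′ ≤ 4 * s′
    cost-step {c} {s} {c′} {s′} a b 3c≤4s c′≤ ≤s′ 3a≤4b = begin
      3 * c′        ≤⟨ *-monoʳ-≤ 3 c′≤ ⟩
      3 * (c + a)   ≡⟨ *-distribˡ-+ 3 c a ⟩
      3 * c + 3 * a ≤⟨ +-mono-≤ 3c≤4s 3a≤4b ⟩
      4 * s + 4 * b ≡⟨ *-distribˡ-+ 4 s b ⟨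
      4 * (s + b)   ≡⟨ cong (4 *_) (+-comm s b) ⟩
      4 * (b + s)   ≤⟨ *-monoʳ-≤ 4 ≤s′ ⟩
      4 * s′        ∎
      where open ≤-Reasoning

    split-mono : ∀ {P P′ B B′ v} → P ⊆ P′ → B ⊆ B′ →
      v ∈ P ⊎ (Dominated P v × toQ v ⊆ B) → v ∈ P′ ⊎ (Dominated P′ v × toQ v ⊆ B′)
    split-mono P⊆ B⊆ (inj₁ v∈P)     = inj₁ (P⊆ v∈P)
    split-mono P⊆ B⊆ (inj₂ (d , i)) = inj₂ (dominated-mono P⊆ d , B⊆ ∘ i)

    add : ∀ {S x} → x ∈ S → (σ : Selection (S - x)) →
          KernelPerfect (Selection.P σ ▸ x) → Selection S
    add {S} {x} x∈S (selection P B P⊆ kp split cost) kp′ =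
      selection (P ▸ x) B (▸⊆ (x∈p-y⇒x∈p S x ∘ P⊆) x∈S) kp′ split′
        (cost-step 1 1 cost
          (≤-trans (+-monoˡ-≤ ∣ B ∣ (∣p▸x∣≤ P x))
            (≤-reflexive (solve 2 (λ p b → p :+ con 1 :+ b := p :+ b :+ con 1) refl ∣ P ∣ ∣ B ∣)))
          (x∈p⇒∣p-x∣<∣p∣ x∈S) (n≤1+n 3))
      where
      open +-*-Solver
      split′ : ∀ {v} → v ∈ S → v ∈ P ▸ x ⊎ (Dominated (P ▸ x) v × toQ v ⊆ B)
      split′ {v} v∈S with v ≟ x
      ... | yes refl = inj₁ (x∈p▸x P x)
      ... | no v≢x   = split-mono (p⊆p▸x P x) id (split (x∈p∧x≢y⇒x∈p-y v∈S v≢x))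

    exclude : ∀ {S x} → x ∈ S → ∣ toQ x ∣ ≤ 1 → (σ : Selection (S - x)) →
              Dominated (Selection.P σ) x → Selection S
    exclude {S} {x} x∈S toQ≤1 (selection P B P⊆ kp split cost) dom =
      selection P (B ∪ toQ x) (x∈p-y⇒x∈p S x ∘ P⊆) kp split′
        (cost-step 1 1 cost
          (≤-trans (+-monoʳ-≤ ∣ P ∣ (≤-trans (∣p∪q∣≤∣p∣+∣q∣ B (toQ x)) (+-monoʳ-≤ ∣ B ∣ toQ≤1)))
            (≤-reflexive (sym (+-assoc ∣ P ∣ ∣ B ∣ 1))))
          (x∈p⇒∣p-x∣<∣p∣ x∈S) (n≤1+n 3))
      where
      split′ : ∀ {v} → v ∈ S → v ∈ P ⊎ (Dominated P v × toQ v ⊆ B ∪ toQ x)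
      split′ {v} v∈S with v ≟ x
      ... | yes refl = inj₂ (dom , q⊆p∪q B (toQ x))
      ... | no v≢x   = split-mono id (p⊆p∪q (toQ x)) (split (x∈p∧x≢y⇒x∈p-y v∈S v≢x))

    add-2cycle : ∀ {S s t} → s ∈ S → t ∈ S → s ≢ t → (σ : Selection (S - t - s)) →
                 KernelPerfect (Selection.P σ ▸ s ▸ t) → Selection S
    add-2cycle {S} {s} {t} s∈S t∈S s≢t (selection P B P⊆ kp split cost) kp′ =
      selection (P ▸ s ▸ t) B
        (▸⊆ (▸⊆ (x∈p-y⇒x∈p S t ∘ x∈p-y⇒x∈p (S - t) s ∘ P⊆) s∈S) t∈S) kp′ split′
        (cost-step 2 2 cost
          (≤-trans (+-monoˡ-≤ ∣ B ∣ (≤-trans (∣p▸x∣≤ (P ▸ s) t) (+-monoˡ-≤ 1 (∣p▸x∣≤ P s))))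
            (≤-reflexive (solve 2 (λ p b → p :+ con 1 :+ con 1 :+ b := p :+ b :+ con 2)
                            refl ∣ P ∣ ∣ B ∣)))
          (≤-trans (s≤s (x∈p⇒∣p-x∣<∣p∣ (x∈p∧x≢y⇒x∈p-y s∈S s≢t))) (x∈p⇒∣p-x∣<∣p∣ t∈S))
          (m≤m+n 6 2))
      where
      open +-*-Solver
      split′ : ∀ {v} → v ∈ S → v ∈ P ▸ s ▸ t ⊎ (Dominated (P ▸ s ▸ t) v × toQ v ⊆ B)
      split′ {v} v∈S with v ≟ t | v ≟ s
      ... | yes refl | _        = inj₁ (x∈p▸x (P ▸ s) t)
      ... | no _     | yes refl = inj₁ (p⊆p▸x (P ▸ s) t (x∈p▸x P s))
      ... | no v≢t   | no v≢s   = split-mono (p⊆p▸x (P ▸ s) t ∘ p⊆p▸x P s) id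
                                    (split (x∈p∧x≢y⇒x∈p-y (x∈p∧x≢y⇒x∈p-y v∈S v≢t) v≢s))

    -- `v` stays out of `P`, dominated by the new member `t`. The members `s` and `t` cost 2 and
    -- `toQ v` costs at most 2; this is the one extension that exhausts the ratio 4/3.
    add-path : ∀ {S s t v} → s ∈ S → t ∈ S → v ∈ S → s ≢ t → t ≢ v → s ≢ v →
               Edge t v → ∣ toQ v ∣ ≤ 2 → (σ : Selection (S - v - t - s)) →
               KernelPerfect (Selection.P σ ▸ s ▸ t) → Selection S
    add-path {S} {s} {t} {v} s∈S t∈S v∈S s≢t t≢v s≢v tv toQ≤2
             (selection P B P⊆ kp split cost) kp′ =
      selection (P ▸ s ▸ t) (B ∪ toQ v)
        (▸⊆ (▸⊆ (x∈p-y⇒x∈p S v ∘ x∈p-y⇒x∈p (S - v) t ∘ x∈p-y⇒x∈p (S - v - t) s ∘ P⊆) s∈S) t∈S)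
        kp′ split′
        (cost-step 4 3 cost
          (≤-trans (+-mono-≤
              (≤-trans (∣p▸x∣≤ (P ▸ s) t) (+-monoˡ-≤ 1 (∣p▸x∣≤ P s)))
              (≤-trans (∣p∪q∣≤∣p∣+∣q∣ B (toQ v)) (+-monoʳ-≤ ∣ B ∣ toQ≤2)))
            (≤-reflexive (solve 2 (λ p b → p :+ con 1 :+ con 1 :+ (b :+ con 2) := p :+ b :+ con 4)
                            refl ∣ P ∣ ∣ B ∣)))
          (≤-trans (s≤s (s≤s (x∈p⇒∣p-x∣<∣p∣
                      (x∈p∧x≢y⇒x∈p-y (x∈p∧x≢y⇒x∈p-y s∈S s≢v) s≢t))))
            (≤-trans (s≤s (x∈p⇒∣p-x∣<∣p∣ (x∈p∧x≢y⇒x∈p-y t∈S t≢v))) (x∈p⇒∣p-x∣<∣p∣ v∈S)))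
          ≤-refl)
      where
      open +-*-Solver
      split′ : ∀ {u} → u ∈ S → u ∈ P ▸ s ▸ t ⊎ (Dominated (P ▸ s ▸ t) u × toQ u ⊆ B ∪ toQ v)
      split′ {u} u∈S with u ≟ v | u ≟ t | u ≟ s
      ... | yes refl | _        | _        = inj₂ ((t , x∈p▸x (P ▸ s) t , tv) , q⊆p∪q B (toQ v))
      ... | no _     | yes refl | _        = inj₁ (x∈p▸x (P ▸ s) t)
      ... | no _     | no _     | yes refl = inj₁ (p⊆p▸x (P ▸ s) t (x∈p▸x P s))
      ... | no u≢v   | no u≢t   | no u≢s   =
        split-mono (p⊆p▸x (P ▸ s) t ∘ p⊆p▸x P s) (p⊆p∪q (toQ v))
          (split (x∈p∧x≢y⇒x∈p-y (x∈p∧x≢y⇒x∈p-y (x∈p∧x≢y⇒x∈p-y u∈S u≢v) u≢t) u≢s))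

    select : ∀ S → (∀ {v} → v ∈ S → v ∉ Q) → Acc _<_ ∣ S ∣ → Selection S
    select S S∌Q (acc rs) with any? (λ x → (x ∈? S) ×-dec ¬? (any? λ y → (y ∈? S) ×-dec edge? x y))
    ... | yes (x , x∈S , ¬out) = add x∈S σ
            (kernelPerfect-sink (Selection.perfect σ)
              (λ y∈P e → ¬out (_ , x∈p-y⇒x∈p S x (Selection.P⊆S σ y∈P) , e)))
      where
      σ : Selection (S - x)
      σ = select (S - x) (S∌Q ∘ x∈p-y⇒x∈p S x) (rs (x∈p⇒∣p-x∣<∣p∣ x∈S))
    ... | no ¬sink with any? (λ x → (x ∈? S) ×-dec (∣ toQ x ∣ ≤? 1))
    -- The selection on `S - x` is made first, since the choice for `x` depends on whether its `P`
    -- dominates `x`.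
    ...   | yes (x , x∈S , toQ≤1) = by-domination (dominated? (Selection.P σ) x)
      where
      σ : Selection (S - x)
      σ = select (S - x) (S∌Q ∘ x∈p-y⇒x∈p S x) (rs (x∈p⇒∣p-x∣<∣p∣ x∈S))
      by-domination : Dec (Dominated (Selection.P σ) x) → Selection S
      by-domination (yes dom) = exclude x∈S toQ≤1 σ dom
      by-domination (no ¬dom) = add x∈S σ (kernelPerfect-source (Selection.perfect σ) ¬dom)
    ...   | no ¬light with nonempty? S
    ...     | no ¬ne = selection ⊥ ⊥ (⊥-elim ∘ ∉⊥) kernelPerfect-⊥ (λ v∈S → ⊥-elim (¬ne (_ , v∈S)))
                         (subst (λ k → 3 * (k + k) ≤ 4 * ∣ S ∣) (sym (∣⊥∣≡0 n)) z≤n)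
    ...     | yes (s , s∈S) = from-path (out s∈S)
      where
      out : ∀ {x} → x ∈ S → ∃ λ y → y ∈ S × Edge x y
      out {x} x∈S with any? (λ y → (y ∈? S) ×-dec edge? x y)
      ... | yes o = o
      ... | no ¬o = ⊥-elim (¬sink (x , x∈S , ¬o))
      -- Two out-neighbours in `S`, hence outside `Q`, would leave at most one in `Q`, against
      -- `¬light`.
      unique : ∀ {x y z} → x ∈ S → y ∈ S → z ∈ S → Edge x y → Edge x z → y ≡ z
      unique {x} {y} {z} x∈S y∈S z∈S xy xz with y ≟ z
      ... | yes eq = eq
      ... | no y≢z = ⊥-elim (¬light (x , x∈S , ∣toQ∣≤1 (S∌Q y∈S) (S∌Q z∈S) xy xz y≢z))
      from-path : (∃ λ y → y ∈ S × Edge s y) → Selection S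
      from-path (t , t∈S , st) with out t∈S
      ... | v , v∈S , tv with v ≟ s
      -- By `unique`, the only out-neighbours of `s` and `t` in `S` are each other, so neither has
      -- an out-edge into `P`.
      ...   | yes refl = add-2cycle s∈S t∈S (edge⇒≢ st) σ
                (kernelPerfect-2cycle (Selection.perfect σ)
                  (λ y∈P e → avoids-t y∈P (unique s∈S (P⊆S y∈P) t∈S e st))
                  (λ y∈P e → avoids-s y∈P (unique t∈S (P⊆S y∈P) s∈S e tv)) st tv)
        where
        s∈S-t : s ∈ S - t
        s∈S-t = x∈p∧x≢y⇒x∈p-y s∈S (edge⇒≢ st)
        σ : Selection (S - t - s)
        σ = select (S - t - s) (S∌Q ∘ x∈p-y⇒x∈p S t ∘ x∈p-y⇒x∈p (S - t) s)
              (rs (<-trans (x∈p⇒∣p-x∣<∣p∣ s∈S-t) (x∈p⇒∣p-x∣<∣p∣ t∈S)))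
        P⊆S : Selection.P σ ⊆ S
        P⊆S = x∈p-y⇒x∈p S t ∘ x∈p-y⇒x∈p (S - t) s ∘ Selection.P⊆S σ
        avoids-s : ∀ {y} → y ∈ Selection.P σ → y ≢ s
        avoids-s y∈P = x∈p-y⇒x≢y (S - t) s (Selection.P⊆S σ y∈P)
        avoids-t : ∀ {y} → y ∈ Selection.P σ → y ≢ t
        avoids-t y∈P = x∈p-y⇒x≢y S t (x∈p-y⇒x∈p (S - t) s (Selection.P⊆S σ y∈P))
      ...   | no v≢s = add-path s∈S t∈S v∈S (edge⇒≢ st) (edge⇒≢ tv) (v≢s ∘ sym) tv
                -- `v` is not a sink of `S` either, so one of its out-edges goes outside `Q`.
                (∣toQ∣≤2 (S∌Q (proj₁ (proj₂ (out v∈S)))) (proj₂ (proj₂ (out v∈S)))) σ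
                -- The order matters: `s` is a sink only while `t` is absent, whereas `t` remains
                -- one after `s` is added, its only out-neighbour in `S` being the omitted `v`.
                (kernelPerfect-sink
                  (kernelPerfect-sink (Selection.perfect σ)
                    (λ y∈P e → avoids-t y∈P (unique s∈S (P⊆S y∈P) t∈S e st)))
                  ¬out-t)
        where
        t∈S-v : t ∈ S - v
        t∈S-v = x∈p∧x≢y⇒x∈p-y t∈S (edge⇒≢ tv)
        s∈S-v-t : s ∈ S - v - t
        s∈S-v-t = x∈p∧x≢y⇒x∈p-y (x∈p∧x≢y⇒x∈p-y s∈S (v≢s ∘ sym)) (edge⇒≢ st)
        σ : Selection (S - v - t - s)
        σ = select (S - v - t - s)
              (S∌Q ∘ x∈p-y⇒x∈p S v ∘ x∈p-y⇒x∈p (S - v) t ∘ x∈p-y⇒x∈p (S - v - t) s)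
              (rs (<-trans (x∈p⇒∣p-x∣<∣p∣ s∈S-v-t)
                    (<-trans (x∈p⇒∣p-x∣<∣p∣ t∈S-v) (x∈p⇒∣p-x∣<∣p∣ v∈S))))
        P⊆S-v-t : Selection.P σ ⊆ S - v - t
        P⊆S-v-t = x∈p-y⇒x∈p (S - v - t) s ∘ Selection.P⊆S σ
        P⊆S : Selection.P σ ⊆ S
        P⊆S = x∈p-y⇒x∈p S v ∘ x∈p-y⇒x∈p (S - v) t ∘ P⊆S-v-t
        avoids-t : ∀ {y} → y ∈ Selection.P σ → y ≢ t
        avoids-t y∈P = x∈p-y⇒x≢y (S - v) t (P⊆S-v-t y∈P)
        avoids-v : ∀ {y} → y ∈ Selection.P σ → y ≢ v
        avoids-v y∈P = x∈p-y⇒x≢y S v (x∈p-y⇒x∈p (S - v) t (P⊆S-v-t y∈P))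
        ¬out-t : ∀ {y} → y ∈ Selection.P σ ▸ s → ¬ Edge t y
        ¬out-t y∈ e with y∈p▸x⁻ (Selection.P σ) s y∈
        ... | inj₁ y∈P  = avoids-v y∈P (unique t∈S (P⊆S y∈P) v∈S e tv)
        ... | inj₂ refl = v≢s (unique t∈S v∈S s∈S tv e)

  -- From a selection to a quasi-kernel.

  quasiKernel : ∀ {Q} → Independent Q → (∀ u → ∃ λ v → v ∈ Q × Near v u) → QuasiKernel Q
  quasiKernel ind reach = record
    { independent = ind
    ; reaches     = λ u → let v , v∈Q , near = reach u in v , v∈Q , near⇒dist near
    }

  selection⇒quasiKernel : ∀ (Δ≤3 : maxOutDegree ≤ 3) {Q} → Sourceless → Independent Q →
    Selection Δ≤3 Q (∁ Q) → ∃ λ K → QuasiKernel K × 3 * ∣ K ∣ ≤ 4 * ∣ ∁ Q ∣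
  selection⇒quasiKernel Δ≤3 {Q} sl indQ (selection P B P⊆ perfect split cost) =
    R ∪ K , quasiKernel independent′ reach
    , ≤-trans (*-monoʳ-≤ 3 (begin
        ∣ R ∪ K ∣     ≤⟨ ∣p∪q∣≤∣p∣+∣q∣ R K ⟩
        ∣ R ∣ + ∣ K ∣ ≤⟨ +-mono-≤ (p⊆q⇒∣p∣≤∣q∣ R⊆B) (p⊆q⇒∣p∣≤∣q∣ K⊆P) ⟩
        ∣ B ∣ + ∣ P ∣ ≡⟨ +-comm ∣ B ∣ ∣ P ∣ ⟩
        ∣ P ∣ + ∣ B ∣ ∎)) cost
    where
    open ≤-Reasoning
    undominated? : ∀ H P → Decidable (λ v → v ∈ H × ¬ Dominated P v)
    undominated? H P v = (v ∈? H) ×-dec ¬? (dominated? P v)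
    R : Subset n
    R = ⟦ undominated? Q P ⟧
    H⊆P : ⟦ undominated? P R ⟧ ⊆ P
    H⊆P h∈ = proj₁ (∈⟦⟧⁻ (undominated? P R) h∈)
    open Kernel (perfect H⊆P)
    K⊆P : K ⊆ P
    K⊆P = H⊆P ∘ K⊆H
    -- An in-neighbour of `r` exists as there are no sources. It is outside `Q` by independence and
    -- outside `P` as `r` is undominated, so `split` puts its out-neighbours in `Q` into `B`.
    R⊆B : R ⊆ B
    R⊆B {r} r∈ with ∈⟦⟧⁻ (undominated? Q P) r∈ | sourceless⇒inNeighbour sl r
    ... | r∈Q , ¬dom | u , e with split (x∉p⇒x∈∁p (λ u∈Q → indQ u∈Q r∈Q e))
    ...   | inj₁ u∈P      = ⊥-elim (¬dom (u , u∈P , e))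
    ...   | inj₂ (_ , i)  = i (x∈p∩q⁺ (r∈Q , e))
    -- Mixed edges are excluded by construction: `K` is drawn from what `R` does not dominate, and
    -- `R` from what `P` does not dominate.
    independent′ : Independent (R ∪ K)
    independent′ u∈ v∈ e with x∈p∪q⁻ R K u∈ | x∈p∪q⁻ R K v∈
    ... | inj₁ u∈R | inj₁ v∈R = indQ (proj₁ (∈⟦⟧⁻ (undominated? Q P) u∈R))
                                     (proj₁ (∈⟦⟧⁻ (undominated? Q P) v∈R)) e
    ... | inj₁ u∈R | inj₂ v∈K = proj₂ (∈⟦⟧⁻ (undominated? P R) (K⊆H v∈K)) (_ , u∈R , e)
    ... | inj₂ u∈K | inj₁ v∈R = proj₂ (∈⟦⟧⁻ (undominated? Q P) v∈R) (_ , K⊆P u∈K , e)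
    ... | inj₂ u∈K | inj₂ v∈K = independent u∈K v∈K e
    absorbs-P : ∀ {p} → p ∈ P → Absorbed (R ∪ K) p
    absorbs-P {p} p∈P with dominated? R p
    ... | yes dom = inj₂ (dominated-mono (p⊆p∪q K) dom)
    ... | no ¬dom = absorbed-mono (q⊆p∪q R K) (absorbs (∈⟦⟧⁺ (undominated? P R) (p∈P , ¬dom)))
    reach-P : ∀ {p} → p ∈ P → ∃ λ v → v ∈ R ∪ K × Near v p
    reach-P p∈P with absorbs-P p∈P
    ... | inj₁ p∈            = _ , p∈ , inj₁ refl
    ... | inj₂ (u , u∈ , e)  = u , u∈ , inj₂ (inj₁ e)
    -- Every vertex of `P` is within one step of `R ∪ K`, so what `P` dominates is within two.
    reach-dominated : ∀ {u} → Dominated P u → ∃ λ v → v ∈ R ∪ K × Near v u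
    reach-dominated (p , p∈P , e) with absorbs-P p∈P
    ... | inj₁ p∈            = p , p∈ , inj₂ (inj₁ e)
    ... | inj₂ (v , v∈ , e′) = v , v∈ , inj₂ (inj₂ (p , e′ , e))
    reach : ∀ u → ∃ λ v → v ∈ R ∪ K × Near v u
    reach u with dominated? P u | u ∈? Q
    ... | yes dom | _       = reach-dominated dom
    ... | no ¬dom | yes u∈Q = u , p⊆p∪q K (∈⟦⟧⁺ (undominated? Q P) (u∈Q , ¬dom)) , inj₁ refl
    ... | no ¬dom | no u∉Q with split (x∉p⇒x∈∁p u∉Q)
    ...   | inj₁ u∈P       = reach-P u∈P
    ...   | inj₂ (dom , _) = ⊥-elim (¬dom dom)

-- The final bound.

3q≤4w⇒7q≤4[q+w] : ∀ q w → 3 * q ≤ 4 * w → 7 * q ≤ 4 * (q + w)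
3q≤4w⇒7q≤4[q+w] q w 3q≤4w = begin
  7 * q         ≡⟨ *-distribʳ-+ q 4 3 ⟩
  4 * q + 3 * q ≤⟨ +-monoʳ-≤ (4 * q) 3q≤4w ⟩
  4 * q + 4 * w ≡⟨ *-distribˡ-+ 4 q w ⟨
  4 * (q + w)   ∎
  where open ≤-Reasoning

theorem1p4 : ∀ (n : ℕ) (D : Digraph n) →
    Digraph.Sourceless D →
    Digraph.maxOutDegree D ≤ 3 →
    ∃ λ (Q : Subset n) → Digraph.QuasiKernel D Q × 7 * ∣ Q ∣ ≤ 4 * n
theorem1p4 n D sl Δ≤3 with quasiKernelOn D ⊤ (<-wellFounded _)
... | Q , _ , ind , reach with 3 * ∣ Q ∣ ≤? 4 * ∣ ∁ Q ∣
...   | yes 3q≤4w = Q , quasiKernel D ind (λ u → reach ∈⊤)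
        , subst (λ m → 7 * ∣ Q ∣ ≤ 4 * m) (∣p∣+∣∁p∣≡n Q) (3q≤4w⇒7q≤4[q+w] ∣ Q ∣ ∣ ∁ Q ∣ 3q≤4w)
...   | no 3q≰4w
  with selection⇒quasiKernel D Δ≤3 sl ind (select D Δ≤3 Q (∁ Q) x∈∁p⇒x∉p (<-wellFounded _))
...     | K , qk , 3k≤4w = K , qk
        , subst (λ m → 7 * ∣ K ∣ ≤ 4 * m) (∣p∣+∣∁p∣≡n Q) (begin
            7 * ∣ K ∣               ≤⟨ 3q≤4w⇒7q≤4[q+w] ∣ K ∣ ∣ ∁ Q ∣ 3k≤4w ⟩
            4 * (∣ K ∣ + ∣ ∁ Q ∣)   ≤⟨ *-monoʳ-≤ 4 (+-monoˡ-≤ ∣ ∁ Q ∣ k≤q) ⟩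
            4 * (∣ Q ∣ + ∣ ∁ Q ∣)   ∎)
  where
  open ≤-Reasoning
  -- With `W` the complement of `Q`, the failed test gives 3 |K| ≤ 4 |W| < 3 |Q|; hence |K| + |W| is
  -- at most `n`.
  k≤q : ∣ K ∣ ≤ ∣ Q ∣
  k≤q = *-cancelˡ-≤ 3 (≤-trans 3k≤4w (<⇒≤ (≰⇒> 3q≰4w)))
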